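{- Given a pattern $P$ of length $m$, a text $T$ of length $n\le \frac32 m$, and a positive integer threshold $k\le m$, at least one of the following holds: \begin{itemize} \item The number of $k$-mismatch occurrences of $P$ in $T$ is bounded by $O(k)$. \item There is a primitive string $Q$ of length $O(m/k)$ that satisfies $\delta_H(P,Q^\infty[0..m))<2k$. \end{itemize}
   Context: Strings are indexed from $0$; $T[i..j)$ denotes the fragment $T[i]\cdots T[j-1]$. $Q^\infty$ is the infinite concatenation of copies of $Q$. A string is primitive if it cannot be written as $U^r$ for a string $U$ and an integer $r>1$. The Hamming distance $\delta_H$ of two equal-length strings is the number of positions where they differ. A $k$-mismatch occurrence of $P$ in $T$ is a position $i$ with $\delta_H(P,T[i..i+m))\le k$. The constants hidden in $O(\cdot)$ are absolute. -}

module Defs where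

open import Data.Fin using (toℕ; fromℕ<)
open import Data.List using (List; length; filter; upTo; allFin; concat; replicate)
open import Data.Nat using (ℕ; suc; _+_; _≤_; _>_; _≤?_; NonZero)
open import Data.Nat.DivMod using (_mod_)
open import Data.Nat.Properties using (≤-irrelevant; <-≤-trans; +-monoʳ-<)
open import Data.Fin.Properties using (toℕ<n)
open import Data.Product using (Σ-syntax; _,_)
open import Data.Vec using (Vec; lookup; tabulate; toList)
open import Relation.Binary.Definitions using (DecidableEquality)
open import Relation.Binary.PropositionalEquality using (_≡_; subst)
open import Relation.Nullary using (¬_; Dec; yes; no; ¬?)

private
  variable
    A : Set
    m n q : ℕ

-- T[i..i+m).
fragment : (T : Vec A n) (i m : ℕ) → i + m ≤ n → Vec A m
fragment T i m i+m≤n =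
  tabulate λ j → lookup T (fromℕ< (<-≤-trans (+-monoʳ-< i (toℕ<n j)) i+m≤n))

infixr 8 _^_
_^_ : List A → ℕ → List A
U ^ r = concat (replicate r U)

-- The empty string is not primitive, since [] ≡ [] ^ 2; hence requiring a
-- primitive string to have type Vec A (suc q) loses no generality.
Primitive : Vec A q → Set
Primitive {A = A} Q = (U : List A) (r : ℕ) → r > 1 → ¬ (toList Q ≡ U ^ r)

-- Q^∞[j].
_^∞_ : Vec A q → .{{NonZero q}} → ℕ → A
_^∞_ {q = q} Q j = lookup Q (j mod q)

-- Q^∞[0..m).
prefix^∞ : Vec A q → .{{NonZero q}} → (m : ℕ) → Vec A m
prefix^∞ Q m = tabulate λ j → Q ^∞ toℕ j

module Hamming (_≟_ : DecidableEquality A) where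

  δ : Vec A n → Vec A n → ℕ
  δ {n = n} u v = length (filter (λ j → ¬? (lookup u j ≟ lookup v j)) (allFin n))

  Occurrence : ℕ → Vec A m → Vec A n → ℕ → Set
  Occurrence {m = m} {n = n} k P T i =
    Σ[ i+m≤n ∈ i + m ≤ n ] δ P (fragment T i m i+m≤n) ≤ k

  occurrence? : (k : ℕ) (P : Vec A m) (T : Vec A n) (i : ℕ) → Dec (Occurrence k P T i)
  occurrence? {m = m} {n = n} k P T i with i + m ≤? n
  ... | no i+m≰n = no λ (i+m≤n , _) → i+m≰n i+m≤n
  ... | yes p with δ P (fragment T i m p) ≤? k
  ...   | yes d = yes (p , d)
  ...   | no ¬d = no λ (p′ , d) →
            ¬d (subst (λ z → δ P (fragment T i m z) ≤ k) (≤-irrelevant p′ p) d)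

  -- Every occurrence i satisfies i ≤ n, so the range upTo (suc n) misses none.
  #occurrences : ℕ → Vec A m → Vec A n → ℕ
  #occurrences {n = n} k P T = length (filter (occurrence? k P T) (upTo (suc n)))

{-# OPTIONS --safe #-}

-- Cut P into K = 2 ^ H blocks of length L, where 4k ≤ K ≤ 8k, and let G = L / 16. By induction on h, a
-- stretch of 2 ^ h blocks either is within fewer than 2 ^ h mismatches of a word with (minimal) period at
-- most G, or it contains disjoint fragments of total weight 2 ^ h such that a fragment of weight w matches
-- T with at most w / 2 mismatches at only O(K) positions. A single block without period at most G has
-- weight 1, since two of its exact occurrences are more than G apart. If one half of a stretch is almost
-- periodic, its period is extended over the other half until 2 ^ (h + 1) mismatches have accumulated; the
-- resulting fragment occurs rarely because each occurrence must be aligned with the period and must pair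
-- at least w / 2 of its w mismatches with mismatches of T, of which there are only O(w) nearby.
--
-- At the root, in the second case each k-mismatch occurrence of P matches fragments of total weight at
-- least K - 2k ≥ K / 2, so there are O(K) occurrences. In the first case P has d < 2K mismatches with
-- a periodic word, and either d < 2k or the same pairing argument applies to P itself.
module Submission where

open import Data.Bool using (if_then_else_; true; false)
open import Data.Empty using (⊥-elim)
open import Data.Fin using (Fin; toℕ; fromℕ<)
open import Data.Fin.Properties using (toℕ-fromℕ<)
open import Data.List using (List; []; _∷_; _++_; length; filter; applyUpTo)
import Data.List as List
open import Data.List.Properties using (length-++; ++-assoc; ++-identityʳ)
open import Data.Nat using (ℕ; zero; suc; _+_; _*_; _∸_; _≤_; _<_; z≤n; s≤s; _≤?_; _<?_; NonZero; >-nonZero)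
import Data.Nat as ℕ
open import Data.Nat.DivMod using (_/_; _%_; _mod_; m≡m%n+[m/n]*n; m%n<n; m/n*n≤m; [m+n]%n≡m%n)
open import Data.Nat.Divisibility using (_∣_; _∣?_; divides; ∣⇒≤)
open import Data.Nat.GCD using (gcd; gcd-GCD; gcd[m,n]∣m; gcd[m,n]∣n; gcd[m,n]≢0; module Bézout)
open import Data.Nat.Properties renaming (_≟_ to _≟ℕ_)
open import Data.Nat.Tactic.RingSolver using (solve-∀)
open import Data.Product using (Σ-syntax; ∃-syntax; _×_; _,_; proj₁; proj₂)
open import Data.Sum using (_⊎_; inj₁; inj₂; [_,_]′)
open import Data.Unit using (⊤; tt)
open import Data.Vec using (Vec; []; _∷_; lookup; tabulate; toList)
open import Data.Vec.Properties using (lookup∘tabulate)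
open import Function using (_∘_; id)
open import Relation.Binary.Definitions using (DecidableEquality)
open import Relation.Binary.PropositionalEquality
open import Relation.Nullary using (¬_; Dec; yes; no; does; ¬?; contradiction)
open import Relation.Unary using (Decidable)
open import Algebra.Properties.CommutativeMonoid.Sum +-0-commutativeMonoid using (sum; ∑-distrib-+; ∑-comm; sum-cong-≗)
open import Algebra.Properties.Semiring.Sum +-*-semiring using (*-distribˡ-sum; *-distribʳ-sum)
open import Defs

-- Arithmetic of truncated subtraction, division and powers of two

m<n∸o⇒o+m<n : ∀ {m n} o → m < n ∸ o → o + m < n
m<n∸o⇒o+m<n {m} {n} o lt =
  subst (_< n) (+-comm m o) (m≤o∸n⇒m+n≤o (suc m) (<⇒≤ (m∸n≢0⇒n<m (m<n⇒n≢0 lt))) lt)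

m<[1+m/n]*n : ∀ m n .{{_ : NonZero n}} → m < suc (m / n) * n
m<[1+m/n]*n m n = subst (_< suc (m / n) * n) (sym (m≡m%n+[m/n]*n m n)) (+-monoˡ-< (m / n * n) (m%n<n m n))

power-of-two-near : ∀ n → 0 < n → ∃[ h ] n ≤ 2 ℕ.^ h × 2 ℕ.^ h ≤ 2 * n
power-of-two-near 1             _ = 0 , ≤-refl , s≤s z≤n
power-of-two-near (suc (suc n)) _ with power-of-two-near (suc n) (s≤s z≤n)
... | h , n≤ , ≤2n with suc n <? 2 ℕ.^ h
...   | yes n< = h , n< , ≤-trans ≤2n (*-monoʳ-≤ 2 (n≤1+n (suc n)))
...   | no n≮  = suc h , ≤-trans (+-mono-≤ (s≤s z≤n) (≤-reflexive (sym (*-identityˡ (suc n))))) (*-monoʳ-≤ 2 n≤)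
                       , *-monoʳ-≤ 2 (≤-trans (≮⇒≥ n≮) (n≤1+n (suc n)))

-- Finite sums over an initial segment of ℕ

∑ : ℕ → (ℕ → ℕ) → ℕ
∑ n f = sum {n} (f ∘ toℕ)

∑-mono : ∀ n {f g} → (∀ i → i < n → f i ≤ g i) → ∑ n f ≤ ∑ n g
∑-mono zero    h = z≤n
∑-mono (suc n) h = +-mono-≤ (h 0 (s≤s z≤n)) (∑-mono n λ i i<n → h (suc i) (s≤s i<n))

∑-cong : ∀ n {f g} → f ≗ g → ∑ n f ≡ ∑ n g
∑-cong n h = sum-cong-≗ {n} (h ∘ toℕ)

∑-+ : ∀ n f g → ∑ n (λ i → f i + g i) ≡ ∑ n f + ∑ n g
∑-+ n f g = ∑-distrib-+ {n} (f ∘ toℕ) (g ∘ toℕ)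

∑-*ˡ : ∀ n c f → ∑ n (λ i → c * f i) ≡ c * ∑ n f
∑-*ˡ n c f = sym (*-distribˡ-sum {n} c (f ∘ toℕ))

∑-*ʳ : ∀ n c f → ∑ n (λ i → f i * c) ≡ ∑ n f * c
∑-*ʳ n c f = sym (*-distribʳ-sum {n} c (f ∘ toℕ))

∑-swap : ∀ m n (f : ℕ → ℕ → ℕ) → ∑ m (λ i → ∑ n (f i)) ≡ ∑ n (λ j → ∑ m (λ i → f i j))
∑-swap m n f = ∑-comm {m} {n} (λ i j → f (toℕ i) (toℕ j))

∑-split : ∀ m n f → ∑ (m + n) f ≡ ∑ m f + ∑ n (f ∘ (m +_))
∑-split zero    n f = refl
∑-split (suc m) n f = trans (cong (f 0 +_) (∑-split m n (f ∘ suc))) (sym (+-assoc (f 0) _ _))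

∑-monoˡ : ∀ {m n} f → m ≤ n → ∑ m f ≤ ∑ n f
∑-monoˡ f z≤n       = z≤n
∑-monoˡ f (s≤s m≤n) = +-monoʳ-≤ (f 0) (∑-monoˡ (f ∘ suc) m≤n)

∑-drop : ∀ s n f → ∑ n (f ∘ (s +_)) ≤ ∑ (s + n) f
∑-drop s n f = ≤-trans (m≤n+m _ (∑ s f)) (≤-reflexive (sym (∑-split s n f)))

∑≡0⇒≡0 : ∀ n f → ∑ n f ≡ 0 → ∀ i → i < n → f i ≡ 0
∑≡0⇒≡0 (suc n) f eq zero    _         = m+n≡0⇒m≡0 (f 0) eq
∑≡0⇒≡0 (suc n) f eq (suc i) (s≤s i<n) = ∑≡0⇒≡0 n (f ∘ suc) (m+n≡0⇒n≡0 (f 0) eq) i i<n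

∑-zero : ∀ n f → (∀ i → i < n → f i ≡ 0) → ∑ n f ≡ 0
∑-zero zero    f h = refl
∑-zero (suc n) f h = cong₂ _+_ (h 0 (s≤s z≤n)) (∑-zero n (f ∘ suc) λ i i<n → h (suc i) (s≤s i<n))

∑-ones : ∀ n → ∑ n (λ _ → 1) ≡ n
∑-ones zero    = refl
∑-ones (suc n) = cong suc (∑-ones n)

-- Cuts a count right after its last hit, so that the end of the range is itself a hit and can be
-- used as one.
∑-last-positive : ∀ n f → ∑ n f ≡ 0 ⊎ (∃[ x ] x < n × 0 < f x × ∑ n f ≡ ∑ (suc x) f)
∑-last-positive zero    f = inj₁ refl
∑-last-positive (suc n) f with ∑-last-positive n (f ∘ suc)
... | inj₂ (x , x<n , pos , eq) = inj₂ (suc x , s≤s x<n , pos , cong (f 0 +_) eq)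
... | inj₁ eq with f 0 in f0
...   | zero  = inj₁ eq
...   | suc c = inj₂ (0 , s≤s z≤n , subst (0 <_) (sym f0) (s≤s z≤n) , cong (suc c +_) eq)

-- `r` consecutive windows of length `W` cover the range, and each contributes at most `c`.
∑-windows : ∀ r {W N c} f → (∀ s → ∑ W (f ∘ (s +_)) ≤ c) → N ≤ r * W → ∑ N f ≤ r * c
∑-windows r {W} {N} {c} f h N≤rW = ≤-trans (∑-monoˡ f N≤rW) (go r f h)
  where
  go : ∀ r f → (∀ s → ∑ W (f ∘ (s +_)) ≤ c) → ∑ (r * W) f ≤ r * c
  go zero    f h = z≤n
  go (suc r) f h = begin
    ∑ (W + r * W) f                ≡⟨ ∑-split W (r * W) f ⟩
    ∑ W f + ∑ (r * W) (f ∘ (W +_)) ≤⟨ +-mono-≤ (h 0) (go r (f ∘ (W +_)) λ s →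
                                        ≤-trans (≤-reflexive (∑-cong W λ i → cong f (sym (+-assoc W s i)))) (h (W + s))) ⟩
    c + r * c                      ∎
    where open ≤-Reasoning

∑-periodic : ∀ n q {f} → (∀ i → f (q + i) ≡ f i) → ∑ (n * q) f ≡ n * ∑ q f
∑-periodic zero    q     h = refl
∑-periodic (suc n) q {f} h =
  trans (∑-split q (n * q) f) (cong (∑ q f +_) (trans (∑-cong (n * q) h) (∑-periodic n q h)))

-- Discrete intermediate values: with terms at most 1 the partial sums skip no number. This cuts off
-- a fragment with an exact number of mismatches.
prefix-with-sum : ∀ n {f} w → (∀ i → f i ≤ 1) → w ≤ ∑ n f → ∃[ ℓ ] ℓ ≤ n × ∑ ℓ f ≡ w
prefix-with-sum n       zero    f≤1 w≤ = 0 , z≤n , refl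
prefix-with-sum (suc n) {f} (suc w) f≤1 w≤ with f 0 in f0 | f≤1 0
... | 0 | _ = let ℓ , ℓ≤n , eq = prefix-with-sum n (suc w) (f≤1 ∘ suc) w≤
              in suc ℓ , s≤s ℓ≤n , trans (cong (_+ ∑ ℓ (f ∘ suc)) f0) eq
... | 1 | _ = let ℓ , ℓ≤n , eq = prefix-with-sum n w (f≤1 ∘ suc) (ℕ.s≤s⁻¹ w≤)
              in suc ℓ , s≤s ℓ≤n , trans (cong (_+ ∑ ℓ (f ∘ suc)) f0) (cong suc eq)
... | suc (suc _) | s≤s ()

suffix-with-sum : ∀ n {f} w → (∀ i → f i ≤ 1) → w ≤ ∑ n f →
                  ∃[ s ] ∃[ ℓ ] s + ℓ ≡ n × ∑ ℓ (f ∘ (s +_)) ≡ w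
suffix-with-sum zero    zero w f≤1 = 0 , 0 , refl , refl
suffix-with-sum (suc n) {f} w f≤1 w≤ with w ≤? ∑ n (f ∘ suc)
... | yes w≤′ = let s , ℓ , eq , eq′ = suffix-with-sum n w (f≤1 ∘ suc) w≤′ in suc s , ℓ , cong suc eq , eq′
-- The tail falls short of `w`, and the first term adds at most 1, so the whole sum is exactly `w`.
... | no  w≰  = 0 , suc n , refl , ≤-antisym (≤-trans (+-monoˡ-≤ _ (f≤1 0)) (≰⇒> w≰)) w≤

-- Indicators, counting by filters, and bounded search

indicator : ∀ {P : Set} → Dec P → ℕ
indicator d = if does d then 1 else 0

indicator≤1 : ∀ {P : Set} (d : Dec P) → indicator d ≤ 1
indicator≤1 (yes _) = ≤-refl
indicator≤1 (no _)  = z≤n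

indicator-yes : ∀ {P : Set} (d : Dec P) → P → indicator d ≡ 1
indicator-yes (yes _) p = refl
indicator-yes (no ¬p) p = contradiction p ¬p

indicator-no : ∀ {P : Set} (d : Dec P) → ¬ P → indicator d ≡ 0
indicator-no (yes p) ¬p = contradiction p ¬p
indicator-no (no _)  ¬p = refl

0<indicator : ∀ {P : Set} (d : Dec P) → 0 < indicator d → P
0<indicator (yes p) _ = p

indicator-⇒ : ∀ {P Q : Set} (d : Dec P) (e : Dec Q) → (P → Q) → indicator d ≤ indicator e
indicator-⇒ (no _)  e h = z≤n
indicator-⇒ (yes p) e h = ≤-reflexive (sym (indicator-yes e (h p)))

indicator-* : ∀ {P : Set} (d : Dec P) {c e} → (P → c ≤ e) → indicator d * c ≤ e
indicator-* (no _)  h = z≤n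
indicator-* (yes p) {c} h = ≤-trans (≤-reflexive (*-identityˡ c)) (h p)

length-filter-tabulate : ∀ {B : Set} {P : B → Set} (P? : Decidable P) {n} (g : Fin n → B) →
                         length (filter P? (List.tabulate g)) ≡ sum (indicator ∘ P? ∘ g)
length-filter-tabulate P? {zero}  g = refl
length-filter-tabulate P? {suc n} g with does (P? (g Fin.zero))
... | true  = cong suc (length-filter-tabulate P? (g ∘ Fin.suc))
... | false = length-filter-tabulate P? (g ∘ Fin.suc)

length-filter-applyUpTo : ∀ {B : Set} {P : B → Set} (P? : Decidable P) (g : ℕ → B) n →
                          length (filter P? (applyUpTo g n)) ≡ ∑ n (indicator ∘ P? ∘ g)
length-filter-applyUpTo P? g zero = refl
length-filter-applyUpTo P? g (suc n) with does (P? (g 0))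
... | true  = cong suc (length-filter-applyUpTo P? (g ∘ suc) n)
... | false = length-filter-applyUpTo P? (g ∘ suc) n

least : ∀ {P : ℕ → Set} → Decidable P → ∀ n →
        (∀ i → i < n → ¬ P i) ⊎ (∃[ i ] i < n × P i × (∀ j → j < i → ¬ P j))
least P? zero = inj₁ λ _ ()
least P? (suc n) with P? 0
... | yes p = inj₂ (0 , s≤s z≤n , p , λ _ ())
... | no ¬p with least (P? ∘ suc) n
...   | inj₁ none = inj₁ λ { zero _ → ¬p ; (suc i) (s≤s i<n) → none i i<n }
...   | inj₂ (i , i<n , p , min) = inj₂ (suc i , s≤s i<n , p , λ { zero _ → ¬p ; (suc j) (s≤s j<i) → min j j<i })

-- Periodic functions

module _ {A : Set} where

  Period : (ℕ → A) → ℕ → Set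
  Period u q = ∀ i → u (q + i) ≡ u i

  record MinimalPeriod (u : ℕ → A) (q : ℕ) : Set where
    field
      positive : 0 < q
      period   : Period u q
      minimal  : ∀ j → 0 < j → j < q → ¬ Period u j
  open MinimalPeriod public

  period-* : ∀ {u q} → Period u q → ∀ c → Period u (c * q)
  period-* {u} {q} per zero    i = refl
  period-* {u} {q} per (suc c) i =
    trans (cong u (+-assoc q (c * q) i)) (trans (per (c * q + i)) (period-* per c i))

  period-difference : ∀ {u a b c} → Period u a → Period u b → c + a ≡ b → Period u c
  period-difference {u} {a} {b} {c} pa pb eq i = begin
    u (c + i)         ≡⟨ pa (c + i) ⟨
    u (a + (c + i))   ≡⟨ cong u (trans (sym (+-assoc a c i)) (cong (_+ i) (trans (+-comm a c) eq))) ⟩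
    u (b + i)         ≡⟨ pb i ⟩
    u i               ∎
    where open ≡-Reasoning

  -- By Bézout, the gcd is a difference of multiples of the two periods.
  period-gcd : ∀ {u a b} → Period u a → Period u b → Period u (gcd a b)
  period-gcd {u} {a} {b} pa pb with Bézout.identity (gcd-GCD a b)
  ... | Bézout.+- x y eq = period-difference (period-* pb y) (period-* pa x) eq
  ... | Bézout.-+ x y eq = period-difference (period-* pa x) (period-* pb y) eq

  period-% : ∀ {u q} .{{_ : NonZero q}} → Period u q → ∀ i → u i ≡ u (i % q)
  period-% {u} {q} per i = begin
    u i                       ≡⟨ cong u (m≡m%n+[m/n]*n i q) ⟩
    u (i % q + i / q * q)     ≡⟨ cong u (+-comm (i % q) _) ⟩
    u (i / q * q + i % q)     ≡⟨ period-* per (i / q) (i % q) ⟩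
    u (i % q)                 ∎
    where open ≡-Reasoning

  -- For minimality, adding the multiple `s * suc q` of the period moves every argument past `s`, so
  -- a period of the shifted word is a period of `u` itself.
  minimalPeriod-shift : ∀ {u q} s → MinimalPeriod u q → MinimalPeriod (u ∘ (s +_)) q
  minimalPeriod-shift {u} {suc q} s mp = record
    { positive = positive mp
    ; period   = λ i → trans (cong u (swap s (suc q) i)) (period mp (s + i))
    ; minimal  = λ j 0<j j<q per → minimal mp j 0<j j<q λ i → begin
        u (j + i)                 ≡⟨ period-* (period mp) s (j + i) ⟨
        u (s * suc q + (j + i))   ≡⟨ cong u (rearrange s q j i) ⟩
        u (s + (j + (s * q + i))) ≡⟨ per (s * q + i) ⟩
        u (s + (s * q + i))       ≡⟨ cong u (rearrange′ s q i) ⟩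
        u (s * suc q + i)         ≡⟨ period-* (period mp) s i ⟩
        u i                       ∎
    }
    where
    open ≡-Reasoning
    swap : ∀ s q i → s + (q + i) ≡ q + (s + i)
    swap = solve-∀
    rearrange : ∀ s q j i → s * suc q + (j + i) ≡ s + (j + (s * q + i))
    rearrange = solve-∀
    rearrange′ : ∀ s q i → s + (s * q + i) ≡ s * suc q + i
    rearrange′ = solve-∀

  -- The gcd of `x` and `q` is again a period and is at most `q`; minimality makes it equal to `q`.
  minimalPeriod-∣ : ∀ {u q} → MinimalPeriod u q → ∀ x → Period u x → q ∣ x
  minimalPeriod-∣ {u} {q} mp x per with gcd x q <? q
  ... | yes gcd<q = ⊥-elim (minimal mp (gcd x q)
                      (n≢0⇒n>0 (gcd[m,n]≢0 x q (inj₂ (m<n⇒n≢0 (positive mp))))) gcd<q (period-gcd per (period mp)))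
  ... | no gcd≮q  = subst (_∣ x)
                      (≤-antisym (∣⇒≤ {{>-nonZero (positive mp)}} (gcd[m,n]∣n x q)) (≮⇒≥ gcd≮q))
                      (gcd[m,n]∣m x q)

  -- Prefixes, powers and primitivity

  Prefix : List A → (ℕ → A) → Set
  Prefix []       u = ⊤
  Prefix (x ∷ xs) u = x ≡ u 0 × Prefix xs (u ∘ suc)

  prefix-++⁻ : ∀ xs {ys u} → Prefix (xs ++ ys) u → Prefix xs u × Prefix ys (u ∘ (length xs +_))
  prefix-++⁻ []       p       = tt , p
  prefix-++⁻ (x ∷ xs) (e , p) = let p₁ , p₂ = prefix-++⁻ xs p in (e , p₁) , p₂

  prefix-++⁺ : ∀ xs {ys u} → Prefix xs u → Prefix ys (u ∘ (length xs +_)) → Prefix (xs ++ ys) u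
  prefix-++⁺ []       _       p₂ = p₂
  prefix-++⁺ (x ∷ xs) (e , p) p₂ = e , prefix-++⁺ xs p p₂

  prefix-cong : ∀ xs {u v} → u ≗ v → Prefix xs u → Prefix xs v
  prefix-cong []       h p       = tt
  prefix-cong (x ∷ xs) h (e , p) = trans e (h 0) , prefix-cong xs (h ∘ suc) p

  prefix-unique : ∀ xs {u v} → Prefix xs u → Prefix xs v → ∀ i → i < length xs → u i ≡ v i
  prefix-unique (x ∷ xs) (e , _) (e′ , _) zero    _         = trans (sym e) e′
  prefix-unique (x ∷ xs) (_ , p) (_ , p′) (suc i) (s≤s i<n) = prefix-unique xs p p′ i i<n

  prefix-tabulate : ∀ n u → Prefix (toList (tabulate {n = n} (u ∘ toℕ))) u
  prefix-tabulate zero    u = tt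
  prefix-tabulate (suc n) u = refl , prefix-tabulate n (u ∘ suc)

  length-tabulate : ∀ n (f : Fin n → A) → length (toList (tabulate f)) ≡ n
  length-tabulate zero    f = refl
  length-tabulate (suc n) f = cong suc (length-tabulate n (f ∘ Fin.suc))

  ^-suc : ∀ (U : List A) r → U ^ r ++ U ≡ U ++ U ^ r
  ^-suc U zero    = sym (++-identityʳ U)
  ^-suc U (suc r) = trans (++-assoc U (U ^ r) U) (cong (U ++_) (^-suc U r))

  length-^ : ∀ (U : List A) r → length (U ^ r) ≡ r * length U
  length-^ U zero    = refl
  length-^ U (suc r) = trans (length-++ U) (cong (length U +_) (length-^ U r))

  -- Rotating U ^ r by length U gives U ^ r again, so a word with period r * length U spelling U ^ r
  -- has period length U.
  minimalPeriod⇒primitive : ∀ {u q} → MinimalPeriod u (suc q) → Primitive (tabulate {n = suc q} (u ∘ toℕ))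
  minimalPeriod⇒primitive mp U 1 (s≤s ()) _
  minimalPeriod⇒primitive {u} {q} mp U (suc (suc r)) _ eq =
    minimal mp ∣U∣ (n≢0⇒n>0 ∣U∣≢0) ∣U∣<q per
    where
    open ≡-Reasoning
    ∣U∣ = length U
    V   = U ^ suc r
    len : ∣U∣ + length V ≡ suc q
    len = begin
      ∣U∣ + length V          ≡⟨ length-++ U ⟨
      length (U ^ suc (suc r)) ≡⟨ cong length eq ⟨
      _                       ≡⟨ length-tabulate (suc q) (u ∘ toℕ) ⟩
      suc q                   ∎
    len′ : suc (suc r) * ∣U∣ ≡ suc q
    len′ = trans (cong (∣U∣ +_) (sym (length-^ U (suc r)))) len
    ∣U∣≢0 : ∣U∣ ≢ 0
    ∣U∣≢0 eq₀ = contradiction (trans (sym (trans (cong (suc (suc r) *_) eq₀) (*-zeroʳ r))) len′) λ ()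
    ∣U∣<q : ∣U∣ < suc q
    ∣U∣<q = subst (∣U∣ <_) len′ (m<m+n ∣U∣ (<-≤-trans (n≢0⇒n>0 ∣U∣≢0) (m≤m+n ∣U∣ (r * ∣U∣))))
    spelled : Prefix (U ++ V) u
    spelled = subst (λ xs → Prefix xs u) eq (prefix-tabulate (suc q) u)
    rotated : Prefix (U ++ V) (u ∘ (∣U∣ +_))
    rotated = subst (λ xs → Prefix xs (u ∘ (∣U∣ +_))) (^-suc U (suc r))
      (prefix-++⁺ V (proj₂ (prefix-++⁻ U spelled))
        (prefix-cong U
          (λ i → trans (sym (period mp i)) (cong u (trans (cong (_+ i) (sym len)) (+-assoc ∣U∣ (length V) i))))
          (proj₁ (prefix-++⁻ U spelled))))
    per : Period u ∣U∣
    per i = begin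
      u (∣U∣ + i)           ≡⟨ period-% (period (minimalPeriod-shift ∣U∣ mp)) i ⟩
      u (∣U∣ + i % suc q)   ≡⟨ prefix-unique (U ++ V) rotated spelled (i % suc q)
                                 (subst (i % suc q <_) (sym (trans (length-++ U) len)) (m%n<n i (suc q))) ⟩
      u (i % suc q)         ≡⟨ period-% (period mp) i ⟨
      u i                   ∎

-- Hamming distance of functions on initial segments

module _ {A : Set} (_≟_ : DecidableEquality A) where

  ne : A → A → ℕ
  ne x y = indicator (¬? (x ≟ y))

  ≡⇒ne≡0 : ∀ {x y} → x ≡ y → ne x y ≡ 0
  ≡⇒ne≡0 {x} {y} x≡y = indicator-no (¬? (x ≟ y)) λ x≢y → x≢y x≡y

  ne≡0⇒≡ : ∀ {x y} → ne x y ≡ 0 → x ≡ y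
  ne≡0⇒≡ {x} {y} eq with x ≟ y
  ... | yes x≡y = x≡y
  ne≡0⇒≡ {x} {y} () | no _

  ne-sym : ∀ x y → ne x y ≡ ne y x
  ne-sym x y = ≤-antisym (indicator-⇒ (¬? (x ≟ y)) (¬? (y ≟ x)) (_∘ sym)) (indicator-⇒ (¬? (y ≟ x)) (¬? (x ≟ y)) (_∘ sym))

  ne≤1 : ∀ x y → ne x y ≤ 1
  ne≤1 x y = indicator≤1 (¬? (x ≟ y))

  ne-triangle : ∀ x y z → ne x z ≤ ne x y + ne y z
  ne-triangle x y z with x ≟ y
  ... | yes refl = ≤-refl
  ... | no _     = ≤-trans (ne≤1 x z) (m≤m+n 1 _)

  -- If `x` differs from `z` but equals `y`, then `y` differs from `z` too. This pairs mismatches of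
  -- a pattern with mismatches of a text.
  ne-common : ∀ x y z → ne x z ≤ ne x y + ne x z * ne y z
  ne-common x y z with x ≟ y
  ... | no _     = ≤-trans (ne≤1 x z) (m≤m+n 1 _)
  ... | yes refl with x ≟ z
  ...   | yes _ = z≤n
  ...   | no _  = ≤-refl

  ham : ℕ → (ℕ → A) → (ℕ → A) → ℕ
  ham ℓ f g = ∑ ℓ λ i → ne (f i) (g i)

  ham-sym : ∀ ℓ f g → ham ℓ f g ≡ ham ℓ g f
  ham-sym ℓ f g = ∑-cong ℓ λ i → ne-sym (f i) (g i)

  ham-triangle : ∀ ℓ f g h → ham ℓ f h ≤ ham ℓ f g + ham ℓ g h
  ham-triangle ℓ f g h = ≤-trans
    (∑-mono ℓ λ i _ → ne-triangle (f i) (g i) (h i))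
    (≤-reflexive (∑-+ ℓ (λ i → ne (f i) (g i)) (λ i → ne (g i) (h i))))

  ham-monoˡ : ∀ {ℓ ℓ′} f g → ℓ ≤ ℓ′ → ham ℓ f g ≤ ham ℓ′ f g
  ham-monoˡ f g = ∑-monoˡ (λ i → ne (f i) (g i))

  ham-congʳ : ∀ ℓ f {g g′} → g ≗ g′ → ham ℓ f g ≡ ham ℓ f g′
  ham-congʳ ℓ f h = ∑-cong ℓ λ i → cong (ne (f i)) (h i)

  ham≡0⇒≡ : ∀ ℓ f g → ham ℓ f g ≡ 0 → ∀ i → i < ℓ → f i ≡ g i
  ham≡0⇒≡ ℓ f g eq i i<ℓ = ne≡0⇒≡ (∑≡0⇒≡0 ℓ _ eq i i<ℓ)

  -- Each of the `n` periods contains a mismatch; otherwise `x` would be a period of `u`, hence a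
  -- multiple of `q`.
  minimalPeriod-ham : ∀ {u q x} → MinimalPeriod u q → ¬ q ∣ x → ∀ n → n ≤ ham (n * q) u (u ∘ (x +_))
  minimalPeriod-ham {u} {q} {x} mp q∤x n = begin
    n                             ≡⟨ *-identityʳ n ⟨
    n * 1                         ≤⟨ *-monoʳ-≤ n (n≢0⇒n>0 differ) ⟩
    n * ham q u (u ∘ (x +_))      ≡⟨ ∑-periodic n q (λ i → cong₂ ne (period mp i) (period mpₓ i)) ⟨
    ham (n * q) u (u ∘ (x +_))    ∎
    where
    open ≤-Reasoning
    mpₓ = minimalPeriod-shift x mp
    instance
      q-nonZero : NonZero q
      q-nonZero = >-nonZero (positive mp)
    differ : ham q u (u ∘ (x +_)) ≢ 0
    differ eq = q∤x (minimalPeriod-∣ mp x λ i → trans (period-% (period mpₓ) i)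
      (trans (sym (ham≡0⇒≡ q u (u ∘ (x +_)) eq (i % q) (m%n<n i q))) (sym (period-% (period mp) i))))

  -- Matches of an almost periodic fragment

  hits : ℕ → (ℕ → A) → ℕ → (ℕ → A) → ℕ → ℕ
  hits ℓ f d t x = indicator (2 * ham ℓ f (t ∘ (x +_)) ≤? d)

  hits-shift : ∀ ℓ f d t s x → hits ℓ f d t (s + x) ≡ hits ℓ f d (t ∘ (s +_)) x
  hits-shift ℓ f d t s x = cong (λ c → indicator (2 * c ≤? d)) (ham-congʳ ℓ f λ i → cong t (+-assoc s x i))

  -- The bound is required for every text, so that shifting the text turns any window into an
  -- initial one.
  hits-windows : ∀ r {W N c} ℓ f d → (∀ t → ∑ W (hits ℓ f d t) ≤ c) → N ≤ r * W → ∀ t → ∑ N (hits ℓ f d t) ≤ r * c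
  hits-windows r {W} ℓ f d h N≤rW t = ∑-windows r (hits ℓ f d t)
    (λ s → ≤-trans (≤-reflexive (∑-cong W (hits-shift ℓ f d t s))) (h (t ∘ (s +_)))) N≤rW

  -- By `room`, the copies of `f` placed at any two positions of a window of length `W` overlap in
  -- at least `3 * d + 1` full periods.
  module _ {f u : ℕ → A} {q ℓ W : ℕ} (mp : MinimalPeriod u q)
           (0<d : 0 < ham ℓ f u) (room : W + (3 * ham ℓ f u + 1) * q ≤ ℓ) where
    private
      d = ham ℓ f u

    near-periodic : ∀ g → 2 * ham ℓ f g ≤ d → 2 * ham ℓ g u ≤ 3 * d
    near-periodic g close = begin
      2 * ham ℓ g u                ≤⟨ *-monoʳ-≤ 2 (ham-triangle ℓ g f u) ⟩
      2 * (ham ℓ g f + d)          ≡⟨ *-distribˡ-+ 2 (ham ℓ g f) d ⟩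
      2 * ham ℓ g f + 2 * d        ≡⟨ cong (λ c → 2 * c + 2 * d) (ham-sym ℓ g f) ⟩
      2 * ham ℓ f g + 2 * d        ≤⟨ +-monoˡ-≤ (2 * d) close ⟩
      d + 2 * d                    ∎
      where open ≤-Reasoning

    module _ (t : ℕ → A) (close₀ : 2 * ham ℓ f t ≤ d) where

      error : ℕ → ℕ
      error i = ne (t i) (u i)

      -- Both fragments of `t` have at most `3 * d / 2` mismatches with `u`, so `u` and its shift by
      -- `x` differ at most `3 * d` times on the overlap. A shift that is not a multiple of `q`
      -- would force `3 * d + 1` differences.
      close⇒∣ : ∀ x → x < W → 2 * ham ℓ f (t ∘ (x +_)) ≤ d → q ∣ x
      close⇒∣ x x<W close with q ∣? x
      ... | yes q∣x = q∣x
      ... | no  q∤x = ⊥-elim (<⇒≱ (m<m+n (6 * d) {2} (s≤s z≤n)) (begin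
        6 * d + 2                          ≡⟨ expand d ⟩
        2 * n                              ≤⟨ *-monoʳ-≤ 2 (minimalPeriod-ham mp q∤x n) ⟩
        2 * ham nq u uₓ                    ≤⟨ *-monoʳ-≤ 2 (ham-triangle nq u tₓ uₓ) ⟩
        2 * (ham nq u tₓ + ham nq tₓ uₓ)   ≤⟨ *-monoʳ-≤ 2 (+-mono-≤ left right) ⟩
        2 * (ham ℓ tₓ u + ham ℓ t u)       ≡⟨ *-distribˡ-+ 2 (ham ℓ tₓ u) _ ⟩
        2 * ham ℓ tₓ u + 2 * ham ℓ t u     ≤⟨ +-mono-≤ (near-periodic tₓ close) (near-periodic t close₀) ⟩
        3 * d + 3 * d                      ≡⟨ collect d ⟩
        6 * d                              ∎))
        where
        open ≤-Reasoning
        n  = 3 * d + 1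
        nq = n * q
        tₓ = t ∘ (x +_)
        uₓ = u ∘ (x +_)
        expand : ∀ d → 6 * d + 2 ≡ 2 * (3 * d + 1)
        expand = solve-∀
        collect : ∀ d → 3 * d + 3 * d ≡ 6 * d
        collect = solve-∀
        left : ham nq u tₓ ≤ ham ℓ tₓ u
        left = ≤-trans (≤-reflexive (ham-sym nq u tₓ)) (ham-monoˡ tₓ u (≤-trans (m≤n+m nq W) room))
        right : ham nq tₓ uₓ ≤ ham ℓ t u
        right = ≤-trans (∑-drop x nq error) (∑-monoˡ error (≤-trans (+-monoˡ-≤ nq (<⇒≤ x<W)) room))

      ham-aligned : ∀ {x} → q ∣ x → ∀ g → ham ℓ g (u ∘ (x +_)) ≡ ham ℓ g u
      ham-aligned (divides c refl) g = ham-congʳ ℓ g (period-* (period mp) c)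

      -- The copies of `f` at 0 and at `x` together cover the first `x + ℓ` positions. Both are
      -- aligned with `u`, and each sees at most `3 * d / 2` errors.
      errors≤3d : ∀ x → x < W → 2 * ham ℓ f (t ∘ (x +_)) ≤ d → ∑ (x + ℓ) error ≤ 3 * d
      errors≤3d x x<W close = *-cancelˡ-≤ 2 (begin
        2 * ∑ (x + ℓ) error                   ≡⟨ cong (2 *_) (∑-split x ℓ error) ⟩
        2 * (∑ x error + ham ℓ tₓ (u ∘ (x +_)))
          ≤⟨ *-monoʳ-≤ 2 (+-mono-≤ (∑-monoˡ error x≤ℓ) (≤-reflexive (ham-aligned (close⇒∣ x x<W close) tₓ))) ⟩
        2 * (ham ℓ t u + ham ℓ tₓ u)          ≡⟨ *-distribˡ-+ 2 (ham ℓ t u) _ ⟩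
        2 * ham ℓ t u + 2 * ham ℓ tₓ u        ≤⟨ +-mono-≤ (near-periodic t close₀) (near-periodic tₓ close) ⟩
        3 * d + 3 * d                         ≡⟨ collect d ⟩
        2 * (3 * d)                           ∎)
        where
        open ≤-Reasoning
        tₓ = t ∘ (x +_)
        x≤ℓ : x ≤ ℓ
        x≤ℓ = ≤-trans (<⇒≤ x<W) (≤-trans (m≤m+n W _) room)
        collect : ∀ d → 3 * d + 3 * d ≡ 2 * (3 * d)
        collect = solve-∀

      aligned-errors : ℕ → ℕ
      aligned-errors x = ∑ ℓ λ i → ne (f i) (u i) * error (x + i)

      -- A mismatch of f against u that t does not repeat is a mismatch of f against t.
      close⇒aligned-errors : ∀ x → x < W → 2 * ham ℓ f (t ∘ (x +_)) ≤ d → d ≤ 2 * aligned-errors x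
      close⇒aligned-errors x x<W close with close⇒∣ x x<W close
      ... | divides c refl = +-cancelˡ-≤ d d _ (begin
        d + d                                                    ≡⟨ cong (d +_) (+-identityʳ d) ⟨
        2 * d                                                    ≤⟨ *-monoʳ-≤ 2 (∑-mono ℓ λ i _ → pointwise i) ⟩
        2 * ∑ ℓ (λ i → ne (f i) (tₓ i) + ne (f i) (u i) * error (x + i))
          ≡⟨ cong (2 *_) (∑-+ ℓ (λ i → ne (f i) (tₓ i)) (λ i → ne (f i) (u i) * error (x + i))) ⟩
        2 * (ham ℓ f tₓ + aligned-errors x)                      ≡⟨ *-distribˡ-+ 2 (ham ℓ f tₓ) _ ⟩
        2 * ham ℓ f tₓ + 2 * aligned-errors x                    ≤⟨ +-monoˡ-≤ _ close ⟩
        d + 2 * aligned-errors x                                 ∎)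
        where
        open ≤-Reasoning
        tₓ = t ∘ (x +_)
        pointwise : ∀ i → ne (f i) (u i) ≤ ne (f i) (tₓ i) + ne (f i) (u i) * error (x + i)
        pointwise i = subst (λ v → ne (f i) (u i) ≤ ne (f i) (tₓ i) + ne (f i) (u i) * ne (tₓ i) v)
          (sym (period-* (period mp) c i)) (ne-common (f i) (tₓ i) (u i))

      -- Double counting of pairs of a mismatch of `f` and an error of `t`: every hit aligns at
      -- least `d / 2` pairs, while each of the `d` mismatches meets each of at most `3 * d` errors
      -- at one position only.
      hits-from-close : ∑ W (hits ℓ f d t) ≤ 6 * d
      hits-from-close with ∑-last-positive W (hits ℓ f d t)
      ... | inj₁ eq = ≤-trans (≤-reflexive eq) z≤n
      ... | inj₂ (x₁ , x₁<W , pos , eq) = *-cancelʳ-≤ _ (6 * d) d {{>-nonZero 0<d}} (begin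
        ∑ W (hits ℓ f d t) * d                              ≡⟨ cong (_* d) eq ⟩
        ∑ (suc x₁) (hits ℓ f d t) * d                       ≡⟨ ∑-*ʳ (suc x₁) d (hits ℓ f d t) ⟨
        ∑ (suc x₁) (λ x → hits ℓ f d t x * d)               ≤⟨ ∑-mono (suc x₁) weigh ⟩
        ∑ (suc x₁) (λ x → 2 * aligned-errors x)             ≡⟨ ∑-*ˡ (suc x₁) 2 aligned-errors ⟩
        2 * ∑ (suc x₁) aligned-errors                       ≡⟨ cong (2 *_) (∑-swap (suc x₁) ℓ (λ x i → ne (f i) (u i) * error (x + i))) ⟩
        2 * ∑ ℓ (λ i → ∑ (suc x₁) (λ x → ne (f i) (u i) * error (x + i)))
          ≤⟨ *-monoʳ-≤ 2 (∑-mono ℓ bound) ⟩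
        2 * ∑ ℓ (λ i → ne (f i) (u i) * (3 * d))            ≡⟨ cong (2 *_) (∑-*ʳ ℓ (3 * d) (λ i → ne (f i) (u i))) ⟩
        2 * (d * (3 * d))                                   ≡⟨ collect d ⟩
        6 * d * d                                           ∎)
        where
        open ≤-Reasoning
        collect : ∀ d → 2 * (d * (3 * d)) ≡ 6 * d * d
        collect = solve-∀
        close₁ : 2 * ham ℓ f (t ∘ (x₁ +_)) ≤ d
        close₁ = 0<indicator (_ ≤? _) pos
        weigh : ∀ x → x < suc x₁ → hits ℓ f d t x * d ≤ 2 * aligned-errors x
        weigh x (s≤s x≤x₁) = indicator-* (_ ≤? _) (close⇒aligned-errors x (≤-<-trans x≤x₁ x₁<W))
        bound : ∀ i → i < ℓ → ∑ (suc x₁) (λ x → ne (f i) (u i) * error (x + i)) ≤ ne (f i) (u i) * (3 * d)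
        bound i i<ℓ = begin
          ∑ (suc x₁) (λ x → ne (f i) (u i) * error (x + i)) ≡⟨ ∑-*ˡ (suc x₁) (ne (f i) (u i)) (λ x → error (x + i)) ⟩
          ne (f i) (u i) * ∑ (suc x₁) (λ x → error (x + i)) ≤⟨ *-monoʳ-≤ (ne (f i) (u i)) (begin
            ∑ (suc x₁) (λ x → error (x + i))  ≡⟨ ∑-cong (suc x₁) (λ x → cong error (+-comm x i)) ⟩
            ∑ (suc x₁) (error ∘ (i +_))       ≤⟨ ∑-drop i (suc x₁) error ⟩
            ∑ (i + suc x₁) error              ≤⟨ ∑-monoˡ error (≤-trans (≤-reflexive (trans (+-suc i x₁) (+-comm (suc i) x₁))) (+-monoʳ-≤ x₁ i<ℓ)) ⟩
            ∑ (x₁ + ℓ) error                  ≤⟨ errors≤3d x₁ x₁<W close₁ ⟩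
            3 * d                             ∎) ⟩
          ne (f i) (u i) * (3 * d)                          ∎

  -- Positions before the first hit are dropped from the window, after which the text starts with a
  -- hit; a shorter window only leaves more room.
  almost-periodic-hits : ∀ {f u q ℓ W} → MinimalPeriod u q → 0 < ham ℓ f u → W + (3 * ham ℓ f u + 1) * q ≤ ℓ →
                         ∀ t → ∑ W (hits ℓ f (ham ℓ f u) t) ≤ 6 * ham ℓ f u
  almost-periodic-hits {W = zero} mp 0<d room t = z≤n
  almost-periodic-hits {f} {u} {q} {ℓ} {suc W} mp 0<d room t with 2 * ham ℓ f t ≤? ham ℓ f u
  ... | yes close = hits-from-close {f} mp 0<d room t close
  ... | no ¬close = ≤-trans
    (≤-reflexive (cong (_+ ∑ W (hits ℓ f (ham ℓ f u) (t ∘ suc))) (indicator-no (_ ≤? _) ¬close)))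
    (almost-periodic-hits {f} mp 0<d (≤-trans (n≤1+n _) room) (t ∘ suc))

  -- Periods and exact matches of a single block

  module _ (L : ℕ) (b : ℕ → A) where

    block-period-* : ∀ {g} → (∀ i → i < L ∸ g → b i ≡ b (g + i)) → ∀ c i → c * g + i < L → b (c * g + i) ≡ b i
    block-period-*     h zero    i <L = refl
    block-period-* {g} h (suc c) i <L = begin
      b (g + c * g + i)   ≡⟨ cong b (+-assoc g (c * g) i) ⟩
      b (g + (c * g + i)) ≡⟨ h (c * g + i) (m+n≤o⇒m≤o∸n (suc (c * g + i)) (subst (_< L) (trans (+-assoc g (c * g) i) (+-comm g _)) <L)) ⟨
      b (c * g + i)       ≡⟨ block-period-* h c i (≤-<-trans (+-monoˡ-≤ i (m≤n+m (c * g) g)) <L) ⟩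
      b i                 ∎
      where open ≡-Reasoning

    -- The word `u` repeats the first `suc g` letters of the block. A smaller period of `u` would be
    -- one of the block.
    least-block-period : ∀ g → ham (L ∸ suc g) b (b ∘ (suc g +_)) ≡ 0 →
                         (∀ j → j < g → ham (L ∸ suc j) b (b ∘ (suc j +_)) ≢ 0) →
                         ∃[ u ] MinimalPeriod u (suc g) × ham L b u ≡ 0
    least-block-period g eq min = u , mp , ∑-zero L _ λ i i<L → ≡⇒ne≡0 (b≡u i i<L)
      where
      u : ℕ → A
      u i = b (i % suc g)
      b≡u : ∀ i → i < L → b i ≡ u i
      b≡u i i<L = trans (cong b split)
        (block-period-* {suc g} (ham≡0⇒≡ (L ∸ suc g) b _ eq) (i / suc g) (i % suc g) (subst (_< L) split i<L))
        where
        split : i ≡ i / suc g * suc g + i % suc g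
        split = trans (m≡m%n+[m/n]*n i (suc g)) (+-comm (i % suc g) _)
      mp : MinimalPeriod u (suc g)
      mp = record
        { positive = s≤s z≤n
        ; period   = λ i → cong b (trans (cong (_% suc g) (+-comm (suc g) i)) ([m+n]%n≡m%n i (suc g)))
        ; minimal  = λ { (suc j) _ (s≤s j<g) per → min j j<g (∑-zero (L ∸ suc j) _ λ i i<L∸j →
            let j+i<L = m<n∸o⇒o+m<n (suc j) i<L∸j
            in ≡⇒ne≡0 (trans (b≡u i (≤-<-trans (m≤n+m i (suc j)) j+i<L))
                      (trans (sym (per i)) (sym (b≡u (suc j + i) j+i<L))))) }
        }

    -- A hit of weight 1 has no mismatch at all, and two exact occurrences at distance `suc x` give
    -- the block that period.
    aperiodic-hits : ∀ {G} → (∀ g → g < G → ham (L ∸ suc g) b (b ∘ (suc g +_)) ≢ 0) →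
                     ∀ W → W ≤ G → ∀ t → ∑ W (hits L b 1 t) ≤ 1
    aperiodic-hits none zero    W≤G t = z≤n
    aperiodic-hits none (suc W) W<G t with 2 * ham L b t ≤? 1
    ... | no ¬hit = ≤-trans
      (≤-reflexive (cong (_+ ∑ W (hits L b 1 (t ∘ suc))) (indicator-no (_ ≤? _) ¬hit)))
      (aperiodic-hits none W (<⇒≤ W<G) (t ∘ suc))
    ... | yes hit = ≤-trans
      (≤-reflexive (cong₂ _+_ (indicator-yes (_ ≤? _) hit)
        (∑-zero W (hits L b 1 (t ∘ suc)) λ x x<W → indicator-no (_ ≤? _) λ hitₓ → none x (<-trans x<W W<G)
          (∑-zero (L ∸ suc x) _ λ i i<L∸x →
            let x+i<L = m<n∸o⇒o+m<n (suc x) i<L∸x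
            in ≡⇒ne≡0 (trans (exact (t ∘ (suc x +_)) hitₓ i (≤-<-trans (m≤n+m i (suc x)) x+i<L))
                             (sym (exact t hit (suc x + i) x+i<L))))))) ≤-refl
      where
      exact : ∀ s → 2 * ham L b s ≤ 1 → ∀ i → i < L → b i ≡ s i
      exact s hit = ham≡0⇒≡ L b s (n<1⇒n≡0 (*-cancelˡ-< 2 _ 1 (s≤s hit)))

  -- The dichotomy for stretches of blocks

  AlmostPeriodic : ℕ → (ℕ → A) → ℕ → ℕ → Set
  AlmostPeriodic G p ℓ w = ∃[ u ] ∃[ q ] MinimalPeriod u q × q ≤ G × ham ℓ p u < w

  -- μ o is the total weight of those chosen disjoint fragments of p that match well at position o of t.
  Sparse : ℕ → ℕ → (ℕ → A) → (ℕ → A) → ℕ → ℕ → Set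
  Sparse N B p t ℓ w = ∃[ μ ] (∀ o → w ≤ μ o + 2 * ham ℓ p (t ∘ (o +_))) × ∑ N μ ≤ w * B

  module _ {G N B : ℕ} where

    -- The single fragment carries the whole weight `w`: where it does not hit, it alone has more
    -- than `w / 2` mismatches.
    sparse-fragment : ∀ p {ℓ w} s ℓ′ → s + ℓ′ ≤ ℓ → (∀ t → ∑ N (hits ℓ′ (p ∘ (s +_)) w t) ≤ B) →
                      ∀ t → Sparse N B p t ℓ w
    sparse-fragment p {ℓ} {w} s ℓ′ s+ℓ′≤ℓ h t =
      (λ o → w * hit o) , enough , ≤-trans (≤-reflexive (∑-*ˡ N w hit)) (*-monoʳ-≤ w (h (t ∘ (s +_))))
      where
      open ≤-Reasoning
      hit = hits ℓ′ (p ∘ (s +_)) w (t ∘ (s +_))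
      ham-fragment : ∀ o → ham ℓ′ (p ∘ (s +_)) ((t ∘ (s +_)) ∘ (o +_)) ≤ ham ℓ p (t ∘ (o +_))
      ham-fragment o = begin
        ham ℓ′ (p ∘ (s +_)) ((t ∘ (s +_)) ∘ (o +_)) ≡⟨ ham-congʳ ℓ′ (p ∘ (s +_)) (λ i → cong t (swap s o i)) ⟩
        ham ℓ′ (p ∘ (s +_)) ((t ∘ (o +_)) ∘ (s +_)) ≤⟨ ∑-drop s ℓ′ (λ i → ne (p i) (t (o + i))) ⟩
        ham (s + ℓ′) p (t ∘ (o +_))                 ≤⟨ ham-monoˡ p (t ∘ (o +_)) s+ℓ′≤ℓ ⟩
        ham ℓ p (t ∘ (o +_))                        ∎
        where
        swap : ∀ s o i → s + (o + i) ≡ o + (s + i)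
        swap = solve-∀
      enough : ∀ o → w ≤ w * hit o + 2 * ham ℓ p (t ∘ (o +_))
      enough o with 2 * ham ℓ′ (p ∘ (s +_)) ((t ∘ (s +_)) ∘ (o +_)) ≤? w
      ... | yes close = ≤-trans (≤-reflexive (sym (trans (cong (w *_) (indicator-yes (_ ≤? _) close)) (*-identityʳ w)))) (m≤m+n _ _)
      ... | no ¬close = ≤-trans (<⇒≤ (≰⇒> ¬close)) (≤-trans (*-monoʳ-≤ 2 (ham-fragment o)) (m≤n+m _ (w * hit o)))

    sparse-region : ∀ p {u q ℓ w W r} s ℓ′ → MinimalPeriod u q → q ≤ G → s + ℓ′ ≤ ℓ →
                    ham ℓ′ (p ∘ (s +_)) (u ∘ (s +_)) ≡ w → 0 < w →
                    W + (3 * w + 1) * G ≤ ℓ′ → N ≤ r * W → r * (6 * w) ≤ B →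
                    ∀ t → Sparse N B p t ℓ w
    sparse-region p {u} {q} {W = W} {r} s ℓ′ mp q≤G s+ℓ′≤ℓ refl 0<w room N≤rW r6w≤B =
      sparse-fragment p s ℓ′ s+ℓ′≤ℓ λ t → ≤-trans
        (hits-windows r ℓ′ (p ∘ (s +_)) _
          (almost-periodic-hits {p ∘ (s +_)} (minimalPeriod-shift s mp) 0<w
            (≤-trans (+-monoʳ-≤ W (*-monoʳ-≤ (3 * ham ℓ′ (p ∘ (s +_)) (u ∘ (s +_)) + 1) q≤G)) room)) N≤rW t)
        r6w≤B

    -- The halves are disjoint, so weights and mismatches both add up.
    sparse-++ : ∀ p t ℓ {w} → Sparse N B p t ℓ w → Sparse N B (p ∘ (ℓ +_)) (t ∘ (ℓ +_)) ℓ w →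
                Sparse N B p t (ℓ + ℓ) (w + w)
    sparse-++ p t ℓ {w} (μ , enough , few) (μ′ , enough′ , few′) =
      (λ o → μ o + μ′ o) , both ,
      ≤-trans (≤-reflexive (∑-+ N μ μ′)) (≤-trans (+-mono-≤ few few′) (≤-reflexive (sym (*-distribʳ-+ B w w))))
      where
      open ≤-Reasoning
      both : ∀ o → w + w ≤ μ o + μ′ o + 2 * ham (ℓ + ℓ) p (t ∘ (o +_))
      both o = begin
        w + w                              ≤⟨ +-mono-≤ (enough o) (enough′ o) ⟩
        (μ o + 2 * h₁) + (μ′ o + 2 * h₂)   ≡⟨ regroup (μ o) (μ′ o) h₁ h₂ ⟩
        μ o + μ′ o + 2 * (h₁ + h₂)         ≡⟨ cong (λ h → μ o + μ′ o + 2 * (h₁ + h))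
                                                (ham-congʳ ℓ (p ∘ (ℓ +_)) λ i → cong t (swap ℓ o i)) ⟩
        μ o + μ′ o + 2 * (h₁ + h₂′)        ≡⟨ cong (λ h → μ o + μ′ o + 2 * h) (∑-split ℓ ℓ (λ i → ne (p i) (t (o + i)))) ⟨
        μ o + μ′ o + 2 * ham (ℓ + ℓ) p (t ∘ (o +_)) ∎
        where
        h₁  = ham ℓ p (t ∘ (o +_))
        h₂  = ham ℓ (p ∘ (ℓ +_)) ((t ∘ (ℓ +_)) ∘ (o +_))
        h₂′ = ham ℓ (p ∘ (ℓ +_)) ((t ∘ (o +_)) ∘ (ℓ +_))
        regroup : ∀ a b c d → (a + 2 * c) + (b + 2 * d) ≡ a + b + 2 * (c + d)
        regroup = solve-∀
        swap : ∀ l o i → l + (o + i) ≡ o + (l + i)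
        swap = solve-∀

    Dichotomy : (p t : ℕ → A) (ℓ w : ℕ) → Set
    Dichotomy p t ℓ w = AlmostPeriodic G p ℓ w ⊎ Sparse N B p t ℓ w

    dichotomy-block : ∀ {L r} → N ≤ r * G → r ≤ B → ∀ p t → Dichotomy p t L 1
    dichotomy-block {L} {r} N≤rG r≤B p t with least (λ g → ham (L ∸ suc g) p (p ∘ (suc g +_)) ≟ℕ 0) G
    ... | inj₂ (g , g<G , eq , min) =
      let u , mp , exact = least-block-period L p g eq min
      in inj₁ (u , suc g , mp , g<G , s≤s (≤-reflexive exact))
    ... | inj₁ none = inj₂ (sparse-fragment p 0 L ≤-refl (λ t → ≤-trans
      (hits-windows r L p 1 (aperiodic-hits L p none G ≤-refl) N≤rG t)
      (≤-trans (≤-reflexive (*-identityʳ r)) r≤B)) t)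

    -- The period of an almost periodic half is compared with the whole stretch. If it fails there,
    -- a prefix or suffix with exactly `w + w` mismatches must reach beyond that half, which makes
    -- it long enough for `sparse-region`.
    dichotomy-double : ∀ ℓ {w r} → 0 < w → (w + w) * G + (3 * (w + w) + 1) * G ≤ ℓ →
                       N ≤ r * ((w + w) * G) → r * (6 * (w + w)) ≤ B →
                       (∀ p t → Dichotomy p t ℓ w) → ∀ p t → Dichotomy p t (ℓ + ℓ) (w + w)
    dichotomy-double ℓ {w} {r} 0<w room N≤ r6w≤B halves p t
      with halves p t | halves (p ∘ (ℓ +_)) (t ∘ (ℓ +_))
    ... | inj₂ left | inj₂ right = inj₂ (sparse-++ p t ℓ left right)
    ... | inj₁ (u , q , mp , q≤G , few) | _ with ham (ℓ + ℓ) p u <? w + w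
    ...   | yes lt = inj₁ (u , q , mp , q≤G , lt)
    ...   | no ¬lt =
      let ℓ′ , ℓ′≤ , eq = prefix-with-sum (ℓ + ℓ) (w + w) (λ i → ne≤1 (p i) (u i)) (≮⇒≥ ¬lt)
          -- A prefix inside the left half would have fewer than `w` mismatches.
          ℓ≤ℓ′ = ≮⇒≥ λ ℓ′<ℓ → <⇒≱ few (≤-trans (m≤m+n w w)
            (≤-trans (≤-reflexive (sym eq)) (ham-monoˡ p u (<⇒≤ ℓ′<ℓ))))
      in inj₂ (sparse-region p {r = r} 0 ℓ′ mp q≤G ℓ′≤ eq (≤-trans 0<w (m≤m+n w w)) (≤-trans room ℓ≤ℓ′) N≤ r6w≤B t)
    dichotomy-double ℓ {w} {r} 0<w room N≤ r6w≤B halves p t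
        | inj₂ _ | inj₁ (v , suc q , mpᵥ , q≤G , few) with ham (ℓ + ℓ) p (v ∘ (ℓ * q +_)) <? w + w
    ...   | yes lt = inj₁ (_ , suc q , minimalPeriod-shift (ℓ * q) mpᵥ , q≤G , lt)
    ...   | no ¬lt =
      let s , ℓ′ , s+ℓ′≡ , eq = suffix-with-sum (ℓ + ℓ) (w + w) (λ i → ne≤1 (p i) (u i)) (≮⇒≥ ¬lt)
      in inj₂ (sparse-region p {r = r} s ℓ′ mp q≤G (≤-reflexive s+ℓ′≡) eq (≤-trans 0<w (m≤m+n w w))
                 (≤-trans room (ℓ≤ℓ′ s ℓ′ s+ℓ′≡ eq)) N≤ r6w≤B t)
      where
      open ≤-Reasoning
      -- ℓ * q + ℓ is a multiple of the period, so u prolongs v by ℓ letters to the left.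
      u : ℕ → A
      u = v ∘ (ℓ * q +_)
      mp : MinimalPeriod u (suc q)
      mp = minimalPeriod-shift (ℓ * q) mpᵥ
      u≗v : ∀ i → u (ℓ + i) ≡ v i
      u≗v i = trans (cong v (shift ℓ q i)) (period-* (period mpᵥ) ℓ i)
        where
        shift : ∀ l q i → l * q + (l + i) ≡ l * suc q + i
        shift = solve-∀
      -- A suffix shorter than `ℓ` would lie in the right half, where `u` agrees with `v` and has
      -- fewer than `w` mismatches.
      ℓ≤ℓ′ : ∀ s ℓ′ → s + ℓ′ ≡ ℓ + ℓ → ham ℓ′ (p ∘ (s +_)) (u ∘ (s +_)) ≡ w + w → ℓ ≤ ℓ′
      ℓ≤ℓ′ s ℓ′ s+ℓ′≡ eq = ≮⇒≥ λ ℓ′<ℓ → <⇒≱ few (+-cancelˡ-≤ (ham ℓ p u) _ _ (begin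
        ham ℓ p u + w                                      ≤⟨ +-mono-≤ (ham-monoˡ p u (ℓ≤s ℓ′<ℓ)) (m≤m+n w w) ⟩
        ham s p u + (w + w)                                ≡⟨ cong (ham s p u +_) eq ⟨
        ham s p u + ham ℓ′ (p ∘ (s +_)) (u ∘ (s +_))       ≡⟨ ∑-split s ℓ′ (λ i → ne (p i) (u i)) ⟨
        ham (s + ℓ′) p u                                   ≡⟨ cong (λ n → ham n p u) s+ℓ′≡ ⟩
        ham (ℓ + ℓ) p u                                    ≡⟨ ∑-split ℓ ℓ (λ i → ne (p i) (u i)) ⟩
        ham ℓ p u + ham ℓ (p ∘ (ℓ +_)) (u ∘ (ℓ +_))        ≡⟨ cong (ham ℓ p u +_) (ham-congʳ ℓ (p ∘ (ℓ +_)) u≗v) ⟩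
        ham ℓ p u + ham ℓ (p ∘ (ℓ +_)) v                   ∎))
        where
        ℓ≤s : ℓ′ < ℓ → ℓ ≤ s
        ℓ≤s ℓ′<ℓ = +-cancelʳ-≤ ℓ′ _ _ (≤-trans (+-monoʳ-≤ ℓ (<⇒≤ ℓ′<ℓ)) (≤-reflexive (sym s+ℓ′≡)))
    dichotomy-double ℓ {w} {r} 0<w room N≤ r6w≤B halves p t
        | inj₂ _ | inj₁ (v , zero , mpᵥ , _) = contradiction (positive mpᵥ) λ ()

    -- Going down one level halves the windows and the weights and doubles their number `r`, so both
    -- products with `r` stay fixed and one `B` serves all levels.
    dichotomy : ∀ {L} → 16 * G ≤ L → ∀ h r → N ≤ r * (2 ℕ.^ h * G) → r * (6 * 2 ℕ.^ h) ≤ B →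
                ∀ p t → Dichotomy p t (2 ℕ.^ h * L) (2 ℕ.^ h)
    dichotomy {L} 16G≤L zero r N≤ r6w≤B p t =
      dichotomy-block {1 * L} {r} (subst (λ g → N ≤ r * g) (*-identityˡ G) N≤) (≤-trans (m≤m*n r 6) r6w≤B) p t
    dichotomy {L} 16G≤L (suc h) r N≤ r6w≤B p t =
      subst₂ (Dichotomy p t) (double-* w L) (double w)
        (dichotomy-double (w * L) {r = r} 0<w room (≤-trans N≤ (≤-reflexive (cong (λ x → r * (x * G)) (sym (double w)))))
          (≤-trans (≤-reflexive (cong (λ x → r * (6 * x)) (double w))) r6w≤B)
          (dichotomy 16G≤L h (r * 2)
            (≤-trans N≤ (≤-reflexive (regroup r w G)))
            (≤-trans (≤-reflexive (regroup′ r w)) r6w≤B)) p t)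
      where
      open ≤-Reasoning
      w = 2 ℕ.^ h
      0<w : 0 < w
      0<w = m^n>0 2 h
      double : ∀ w → w + w ≡ 2 * w
      double = solve-∀
      double-* : ∀ w L → w * L + w * L ≡ 2 * w * L
      double-* = solve-∀
      regroup : ∀ r w G → r * (2 * w * G) ≡ r * 2 * (w * G)
      regroup = solve-∀
      regroup′ : ∀ r w → r * 2 * (6 * w) ≡ r * (6 * (2 * w))
      regroup′ = solve-∀
      -- Window and overlap take `(8 * w + 1) * G`, at most `16 * w * G` because `w` is positive;
      -- hence blocks of length at least `16 * G`.
      room : (w + w) * G + (3 * (w + w) + 1) * G ≤ w * L
      room = begin
        (w + w) * G + (3 * (w + w) + 1) * G ≡⟨ collect w G ⟩
        (8 * w + 1) * G                     ≤⟨ *-monoˡ-≤ G (+-monoʳ-≤ (8 * w) (≤-trans 0<w (m≤n*m w 8))) ⟩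
        (8 * w + 8 * w) * G                 ≡⟨ collect′ w G ⟩
        w * (16 * G)                        ≤⟨ *-monoʳ-≤ w 16G≤L ⟩
        w * L                               ∎
        where
        collect : ∀ w G → (w + w) * G + (3 * (w + w) + 1) * G ≡ (8 * w + 1) * G
        collect = solve-∀
        collect′ : ∀ w G → (8 * w + 8 * w) * G ≡ w * (16 * G)
        collect′ = solve-∀

  -- The two cases at the root

  few-matches-or-almost-periodic :
    ∀ {C} → 6144 ≤ C → ∀ {m N k} (p t : ℕ → A) → N ≤ 2 * m → 0 < k →
    ∑ N (λ o → indicator (ham m p (t ∘ (o +_)) ≤? k)) ≤ C * k
    ⊎ (∃[ u ] ∃[ q ] MinimalPeriod u q × q * k ≤ m × ham m p u < 2 * k)
  few-matches-or-almost-periodic {C} 6144≤C {m} {N} {k} p t N≤2m 0<k =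
    [ (λ 0<G → [ almostPeriodic⇒ 0<G , inj₁ ∘ sparse⇒few 0<G ]′
        -- At the root 64 windows of length `K * G` cover all positions, with at most `6 * K` hits
        -- each, and 384 is `64 * 6`.
        (dichotomy {G} {N} {384 * K} 16G≤L H 64 (N≤64KG 0<G) (≤-reflexive (sym (*-assoc 64 6 K))) p t))
    , inj₁ ∘ short ∘ sym ]′ (m≤n⇒m<n∨m≡n {0} {G} z≤n)
    where
    open ≤-Reasoning
    scale = power-of-two-near (4 * k) (≤-trans 0<k (m≤n*m k 4))
    H = proj₁ scale
    K = 2 ℕ.^ H
    4k≤K : 4 * k ≤ K
    4k≤K = proj₁ (proj₂ scale)
    K≤8k : K ≤ 2 * (4 * k)
    K≤8k = proj₂ (proj₂ scale)
    instance
      K-nonZero : NonZero K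
      K-nonZero = >-nonZero (m^n>0 2 H)
    L = m / K
    G = L / 16

    match : ℕ → ℕ
    match o = indicator (ham m p (t ∘ (o +_)) ≤? k)

    -- Both cases end with at most `768 * K` matches; `K ≤ 8 * k` turns this into `6144 * k`.
    768K≤ : 768 * K ≤ C * k
    768K≤ = begin
      768 * K              ≤⟨ *-monoʳ-≤ 768 K≤8k ⟩
      768 * (2 * (4 * k))  ≡⟨ cong (768 *_) (*-assoc 2 4 k) ⟨
      768 * (8 * k)        ≡⟨ *-assoc 768 8 k ⟨
      6144 * k             ≤⟨ *-monoˡ-≤ k 6144≤C ⟩
      C * k                ∎

    KL≤m : K * L ≤ m
    KL≤m = ≤-trans (≤-reflexive (*-comm K L)) (m/n*n≤m m K)

    16G≤L : 16 * G ≤ L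
    16G≤L = ≤-trans (≤-reflexive (*-comm 16 G)) (m/n*n≤m L 16)

    -- Both divisions, by `K` and by 16, are rounded up.
    N≤ : N ≤ 32 * (suc G * K)
    N≤ = begin
      N                        ≤⟨ N≤2m ⟩
      2 * m                    ≤⟨ *-monoʳ-≤ 2 (<⇒≤ (m<[1+m/n]*n m K)) ⟩
      2 * (suc L * K)          ≤⟨ *-monoʳ-≤ 2 (*-monoˡ-≤ K (m<[1+m/n]*n L 16)) ⟩
      2 * (suc G * 16 * K)     ≡⟨ collect 16 (suc G) K ⟩
      32 * (suc G * K)         ∎
      where
      collect : ∀ c g K → 2 * (g * c * K) ≡ 2 * c * (g * K)
      collect = solve-∀

    Goal : Set
    Goal = ∑ N match ≤ C * k ⊎ (∃[ u ] ∃[ q ] MinimalPeriod u q × q * k ≤ m × ham m p u < 2 * k)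

    -- With `G` zero there are only `O(K)` positions, so all of them may be counted.
    short : G ≡ 0 → ∑ N match ≤ C * k
    short G≡0 = begin
      ∑ N match         ≤⟨ ∑-mono N (λ o _ → indicator≤1 (ham m p (t ∘ (o +_)) ≤? k)) ⟩
      ∑ N (λ _ → 1)     ≡⟨ ∑-ones N ⟩
      N                 ≤⟨ N≤ ⟩
      32 * (suc G * K)  ≡⟨ cong (λ g → 32 * (suc g * K)) G≡0 ⟩
      32 * (1 * K)      ≡⟨ cong (32 *_) (*-identityˡ K) ⟩
      32 * K            ≤⟨ *-monoˡ-≤ K (m≤m+n 32 736) ⟩
      768 * K           ≤⟨ 768K≤ ⟩
      C * k          ∎

    module _ (0<G : 0 < G) where

      N≤64KG : N ≤ 64 * (K * G)
      N≤64KG = begin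
        N                     ≤⟨ N≤ ⟩
        32 * (suc G * K)      ≤⟨ *-monoʳ-≤ 32 (*-monoˡ-≤ K (+-monoˡ-≤ G 0<G)) ⟩
        32 * ((G + G) * K)    ≡⟨ collect 32 G K ⟩
        64 * (K * G)          ∎
        where
        collect : ∀ c G K → c * ((G + G) * K) ≡ 2 * c * (K * G)
        collect = solve-∀

      -- A match loses at most `2 * k`, hence at most `K / 2`, of the total weight `K`, so `μ` is at
      -- least `K / 2` there.
      sparse⇒few : Sparse N (384 * K) p t (K * L) K → ∑ N match ≤ C * k
      sparse⇒few (μ , enough , few) = ≤-trans (*-cancelʳ-≤ (∑ N match) (768 * K) K (begin
        ∑ N match * K             ≡⟨ ∑-*ʳ N K match ⟨
        ∑ N (λ o → match o * K)   ≤⟨ ∑-mono N (λ o _ → indicator-* (ham m p (t ∘ (o +_)) ≤? k) (heavy o)) ⟩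
        ∑ N (λ o → 2 * μ o)       ≡⟨ ∑-*ˡ N 2 μ ⟩
        2 * ∑ N μ                 ≤⟨ *-monoʳ-≤ 2 few ⟩
        2 * (K * (384 * K))       ≡⟨ collect 384 K ⟩
        768 * K * K               ∎)) 768K≤
        where
        collect : ∀ c K → 2 * (K * (c * K)) ≡ 2 * c * K * K
        collect = solve-∀
        heavy : ∀ o → ham m p (t ∘ (o +_)) ≤ k → K ≤ 2 * μ o
        heavy o occ = +-cancelʳ-≤ K _ _ (begin
          K + K                         ≡⟨ cong (K +_) (+-identityʳ K) ⟨
          2 * K                         ≤⟨ *-monoʳ-≤ 2 (enough o) ⟩
          2 * (μ o + 2 * ham (K * L) p (t ∘ (o +_)))
            ≤⟨ *-monoʳ-≤ 2 (+-monoʳ-≤ (μ o) (*-monoʳ-≤ 2 (≤-trans (ham-monoˡ p (t ∘ (o +_)) KL≤m) occ))) ⟩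
          2 * (μ o + 2 * k)             ≡⟨ expand (μ o) k ⟩
          2 * μ o + 4 * k               ≤⟨ +-monoʳ-≤ (2 * μ o) 4k≤K ⟩
          2 * μ o + K                   ∎)
          where
          expand : ∀ μ k → 2 * (μ + 2 * k) ≡ 2 * μ + 4 * k
          expand = solve-∀

      -- The fewer than `K` letters left over after the last block are all counted as mismatches.
      ham<2K : ∀ u → ham (K * L) p u < K → ham m p u < K + K
      ham<2K u lt = begin-strict
        ham m p u                           ≡⟨ cong (λ n → ham n p u) m≡ ⟩
        ham (K * L + m % K) p u             ≡⟨ ∑-split (K * L) (m % K) (λ i → ne (p i) (u i)) ⟩
        ham (K * L) p u + ∑ (m % K) rest    ≤⟨ +-monoʳ-≤ (ham (K * L) p u) (∑-mono (m % K) (λ i _ → ne≤1 (p (K * L + i)) (u (K * L + i)))) ⟩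
        ham (K * L) p u + ∑ (m % K) (λ _ → 1) ≡⟨ cong (ham (K * L) p u +_) (∑-ones (m % K)) ⟩
        ham (K * L) p u + m % K             <⟨ +-mono-< lt (m%n<n m K) ⟩
        K + K                               ∎
        where
        rest : ℕ → ℕ
        rest i = ne (p (K * L + i)) (u (K * L + i))
        m≡ : m ≡ K * L + m % K
        m≡ = trans (m≡m%n+[m/n]*n m K) (trans (+-comm (m % K) (L * K)) (cong (_+ m % K) (*-comm L K)))

      -- If `d` is at least `2 * k`, every match has at most `d / 2` mismatches, so the bound for
      -- almost periodic fragments applies to the whole pattern.
      almostPeriodic⇒ : AlmostPeriodic G p (K * L) K → Goal
      almostPeriodic⇒ (u , q , mp , q≤G , lt) =
        choose (<-≤-connex d (2 * k))
        where
        d = ham m p u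
        qk≤m : q * k ≤ m
        qk≤m = begin
          q * k   ≤⟨ *-mono-≤ (≤-trans q≤G (≤-trans (m≤n*m G 16) 16G≤L)) (≤-trans (m≤n*m k 4) 4k≤K) ⟩
          L * K   ≤⟨ m/n*n≤m m K ⟩
          m       ∎
        collect : ∀ c K → c * (K + K) ≡ 2 * c * K
        collect = solve-∀
        expand : ∀ d → 3 * suc d ≡ 3 * d + 1 + 2
        expand = solve-∀
        collect′ : ∀ K G → K * G + 3 * (K + K) * G ≡ K * (7 * G)
        collect′ = solve-∀
        room : K * G + (3 * d + 1) * q ≤ m
        room = begin
          K * G + (3 * d + 1) * q       ≤⟨ +-monoʳ-≤ (K * G) (*-mono-≤ (≤-trans (m≤m+n (3 * d + 1) 2)
                                             (≤-trans (≤-reflexive (sym (expand d))) (*-monoʳ-≤ 3 (ham<2K u lt)))) q≤G) ⟩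
          K * G + 3 * (K + K) * G       ≡⟨ collect′ K G ⟩
          K * (7 * G)                   ≤⟨ *-monoʳ-≤ K (*-monoˡ-≤ G (m≤m+n 7 9)) ⟩
          K * (16 * G)                  ≤⟨ *-monoʳ-≤ K 16G≤L ⟩
          K * L                         ≤⟨ KL≤m ⟩
          m                             ∎
        few : 2 * k ≤ d → ∑ N match ≤ C * k
        few 2k≤d = begin
          ∑ N match           ≤⟨ ∑-mono N (λ o _ → indicator-⇒
                                   (ham m p (t ∘ (o +_)) ≤? k) (2 * ham m p (t ∘ (o +_)) ≤? d) λ occ → ≤-trans (*-monoʳ-≤ 2 occ) 2k≤d) ⟩
          ∑ N (hits m p d t)  ≤⟨ hits-windows 64 {K * G} m p d (almost-periodic-hits {p} {u} {q} {m} {K * G} mp 0<d room) N≤64KG t ⟩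
          64 * (6 * d)        ≤⟨ *-monoʳ-≤ 64 (*-monoʳ-≤ 6 (<⇒≤ (ham<2K u lt))) ⟩
          64 * (6 * (K + K))  ≡⟨ *-assoc 64 6 (K + K) ⟨
          384 * (K + K)       ≡⟨ collect 384 K ⟩
          768 * K             ≤⟨ 768K≤ ⟩
          C * k            ∎
          where
          0<d : 0 < d
          0<d = ≤-trans (≤-trans 0<k (m≤n*m k 2)) 2k≤d
        choose : d < 2 * k ⊎ 2 * k ≤ d → Goal
        choose (inj₁ near) = inj₂ (u , q , mp , qk≤m , near)
        choose (inj₂ 2k≤d) = inj₁ (few 2k≤d)

-- From vectors to functions on the naturals

extend : ∀ {A : Set} {n} → A → Vec A n → ℕ → A
extend a []       i       = a
extend a (x ∷ xs) zero    = x
extend a (x ∷ xs) (suc i) = extend a xs i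

extend-lookup : ∀ {A : Set} {n} (a : A) (xs : Vec A n) i → extend a xs (toℕ i) ≡ lookup xs i
extend-lookup a (x ∷ xs) Fin.zero    = refl
extend-lookup a (x ∷ xs) (Fin.suc i) = extend-lookup a xs i

module _ {A : Set} (_≟_ : DecidableEquality A) where
  open Hamming _≟_

  δ≡ham : ∀ {n} (u v : Vec A n) f g → (∀ j → lookup u j ≡ f (toℕ j)) → (∀ j → lookup v j ≡ g (toℕ j)) →
          δ u v ≡ ham _≟_ n f g
  δ≡ham {n} u v f g hu hv = trans
    (length-filter-tabulate (λ j → ¬? (lookup u j ≟ lookup v j)) id)
    (sum-cong-≗ {n} λ j → cong₂ (ne _≟_) (hu j) (hv j))

  lookup-fragment : ∀ {n} a (T : Vec A n) i m (i+m≤n : i + m ≤ n) j →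
                    lookup (fragment T i m i+m≤n) j ≡ extend a T (i + toℕ j)
  lookup-fragment a T i m i+m≤n j = trans (lookup∘tabulate _ j)
    (trans (sym (extend-lookup a T (fromℕ< _))) (cong (extend a T) (toℕ-fromℕ< _)))

  -- Only an upper bound: the padded text may also match at positions where the pattern runs past
  -- the end of `T`.
  #occurrences≤ : ∀ {m n} a k (P : Vec A m) (T : Vec A n) →
                  #occurrences k P T ≤
                  ∑ (suc n) (λ o → indicator (ham _≟_ m (extend a P) (extend a T ∘ (o +_)) ≤? k))
  #occurrences≤ {m} {n} a k P T = ≤-trans
    (≤-reflexive (length-filter-applyUpTo (occurrence? k P T) id (suc n)))
    (∑-mono (suc n) λ o _ → indicator-⇒ (occurrence? k P T o) (ham _≟_ m (extend a P) (extend a T ∘ (o +_)) ≤? k) λ (o+m≤n , close) →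
      subst (_≤ k) (δ≡ham P (fragment T o m o+m≤n) (extend a P) (extend a T ∘ (o +_))
        (λ j → sym (extend-lookup a P j)) (lookup-fragment a T o m o+m≤n)) close)

  lookup-prefix^∞ : ∀ {u : ℕ → A} {q} → MinimalPeriod u (suc q) → ∀ m j →
                    lookup (prefix^∞ (tabulate {n = suc q} (u ∘ toℕ)) m) j ≡ u (toℕ j)
  lookup-prefix^∞ {u} {q} mp m j = begin
    lookup (prefix^∞ (tabulate (u ∘ toℕ)) m) j   ≡⟨ lookup∘tabulate _ j ⟩
    lookup (tabulate (u ∘ toℕ)) (toℕ j mod suc q) ≡⟨ lookup∘tabulate (u ∘ toℕ) (toℕ j mod suc q) ⟩
    u (toℕ (toℕ j mod suc q))                     ≡⟨ cong u (toℕ-fromℕ< (m%n<n (toℕ j) (suc q))) ⟩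
    u (toℕ j % suc q)                             ≡⟨ period-% (period mp) (toℕ j) ⟨
    u (toℕ j)                                     ∎
    where open ≡-Reasoning

few-occurrences-or-almost-periodic :
  ∀ {C} → 6144 ≤ C → {A : Set} (_≟_ : DecidableEquality A) → let open Hamming _≟_ in
  (m n k : ℕ) (P : Vec A m) (T : Vec A n) → 2 * n ≤ 3 * m → 1 ≤ k → k ≤ m →
  #occurrences k P T ≤ C * k
  ⊎ (Σ[ q ∈ ℕ ] Σ[ Q ∈ Vec A (suc q) ]
      (Primitive Q × suc q * k ≤ 1 * m × δ P (prefix^∞ Q m) < 2 * k))
few-occurrences-or-almost-periodic 6144≤C _≟_ zero    n k P         T 2n≤3m 1≤k k≤0 = contradiction (≤-trans 1≤k k≤0) λ ()
-- The first letter `a` of the pattern serves as the padding.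
few-occurrences-or-almost-periodic 6144≤C _≟_ (suc m) n k P@(a ∷ _) T 2n≤3m 1≤k k≤m =
  [ (λ few → inj₁ (≤-trans (#occurrences≤ _≟_ a k P T) few)) , inj₂ ∘ approximate ]′
    (few-matches-or-almost-periodic _≟_ 6144≤C {suc m} {suc n} {k} (extend a P) (extend a T) n<2m 1≤k)
  where
  open Hamming _≟_
  -- The inequality is strict because the count runs over the `suc n` positions up to `n`.
  n<2m : n < 2 * suc m
  n<2m = *-cancelˡ-< 2 n (2 * suc m) (≤-<-trans 2n≤3m
    (<-≤-trans (*-monoˡ-< (suc m) {3} {4} ≤-refl) (≤-reflexive (*-assoc 2 2 (suc m)))))
  approximate :
    ∃[ u ] ∃[ q ] MinimalPeriod u q × q * k ≤ suc m × ham _≟_ (suc m) (extend a P) u < 2 * k →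
    Σ[ q ∈ ℕ ] Σ[ Q ∈ Vec _ (suc q) ]
      (Primitive Q × suc q * k ≤ 1 * suc m × δ P (prefix^∞ Q (suc m)) < 2 * k)
  approximate (u , zero  , mp , _) = contradiction (positive mp) λ ()
  approximate (u , suc q , mp , short , near) =
    q , tabulate (u ∘ toℕ) , minimalPeriod⇒primitive mp ,
    ≤-trans short (≤-reflexive (sym (*-identityˡ (suc m)))) ,
    subst (_< 2 * k)
      (sym (δ≡ham _≟_ P (prefix^∞ (tabulate {n = suc q} (u ∘ toℕ)) (suc m)) (extend a P) u
        (λ j → sym (extend-lookup a P j)) (lookup-prefix^∞ _≟_ mp (suc m)))) near

theorem4 : Σ[ C₁ ∈ ℕ ] Σ[ C₂ ∈ ℕ ]
    ({A : Set} (_≟_ : DecidableEquality A) → let open Hamming _≟_ in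
    (m n k : ℕ) (P : Vec A m) (T : Vec A n) →
    2 * n ≤ 3 * m → 1 ≤ k → k ≤ m →
    #occurrences k P T ≤ C₁ * k
    ⊎ (Σ[ q ∈ ℕ ] Σ[ Q ∈ Vec A (suc q) ]
    (Primitive Q × suc q * k ≤ C₂ * m × δ P (prefix^∞ Q m) < 2 * k)))
theorem4 = 6144 , 1 , few-occurrences-or-almost-periodic ≤-refl
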